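{- Let $m\ge2$ and let $\mathbf t\in\{0,1,\dots,m-1\}^{\mathbb N}$ be the $m$-bonacci word, i.e. the fixed point of the substitution $\sigma_m$ given by $\sigma_m(i)=0(i+1)$ for $0\le i<m-1$ and $\sigma_m(m-1)=0$. Put $\mathbf g=0\mathbf t$ and consider the partition $\mathbb N=\bigcup_{0\le k\le m-1}\mathbf g\big|_k$. Then for each $0\le k\le m-1$ the set $\mathbf g\big|_k$ is an IP-set (equivalently, a central set).
   Context: $\mathbb N=\{0,1,2,\dots\}$; $\mathbf g\big|_k=\{n\in\mathbb N:\mathbf g_n=k\}$. A set $A\subseteq\mathbb N$ is an IP-set if there is $x_0<x_1<\cdots$ in $\mathbb N$ with all finite sums $\sum_{n\in F}x_n$ ($F$ non-empty finite) in $A$. With $\beta\mathbb N$ the ultrafilters on $\mathbb N$ and $p+q=\{A:\{n:A-n\in p\}\in q\}$ ($A-n=\{j:j+n\in A\}$), $A$ is central if it belongs to some non-principal $p=p+p$ in the smallest two-sided ideal of $\beta\mathbb N$. -}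

module Defs where

open import Data.Nat using (ℕ; zero; suc; _<_; _<ᵇ_; _+_)
open import Data.Bool using (if_then_else_)
open import Data.List using (List; []; _∷_; length; lookup; map; concatMap; upTo)
open import Data.Nat.ListAction using (sum)
open import Data.List.Relation.Unary.Unique.Propositional using (Unique)
open import Data.Fin using (fromℕ<)
open import Relation.Binary.PropositionalEquality using (_≡_; _≢_)
open import Data.Product using (Σ; _×_)

σ : ℕ → ℕ → List ℕ
σ m i = if suc i <ᵇ m then 0 ∷ suc i ∷ [] else 0 ∷ []

σ* : ℕ → List ℕ → List ℕ
σ* m = concatMap (σ m)

IsPrefixOf : List ℕ → (ℕ → ℕ) → Set
IsPrefixOf w t = ∀ i (p : i < length w) → lookup w (fromℕ< p) ≡ t i

prefix : (ℕ → ℕ) → ℕ → List ℕ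
prefix t n = map t (upTo n)

-- t ∈ {0,…,m-1}^ℕ is a fixed point of σ_m, i.e. σ_m(t) = t:
-- σ_m(t) is the limit of σ_m(t_0…t_{n-1}), so σ_m(t) = t iff every
-- σ_m(t_0…t_{n-1}) is a prefix of t (σ_m is non-erasing).
IsFixedPoint : ℕ → (ℕ → ℕ) → Set
IsFixedPoint m t = (∀ n → t n < m) × (∀ n → IsPrefixOf (σ* m (prefix t n)) t)

cons0 : (ℕ → ℕ) → ℕ → ℕ
cons0 t zero = 0
cons0 t (suc n) = t n

level : (ℕ → ℕ) → ℕ → ℕ → Set
level g k n = g n ≡ k

StrictlyIncreasing : (ℕ → ℕ) → Set
StrictlyIncreasing x = ∀ n → x n < x (suc n)

-- IP-set: there are x_0 < x_1 < ⋯ with all sums Σ_{n∈F} x_n (F finite non-empty) in A.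
-- A finite non-empty F ⊆ ℕ is given as a non-empty duplicate-free list.
IsIPSet : (ℕ → Set) → Set
IsIPSet A = Σ (ℕ → ℕ) λ x → StrictlyIncreasing x ×
  (∀ (F : List ℕ) → F ≢ [] → Unique F → A (sum (map x F)))

-- Write σ^j(i) for the j-th iterate of σ_m on the letter i and L_j = |σ^j(0)|.
-- Since σ(0) = 01 and σ(i) begins with 0, σ^{j+2}(0) = σ^{j+1}(0) σ^j(0) …, so
-- the prefix of t of length L_j reappears at position L_{j+1}; in g = 0t this
-- reads g(L_{j+1} + n) = g(n) for 0 < n ≤ L_j.  Moreover g(L_j) is the last
-- letter of σ^j(0), which is j mod m.  Hence, choosing exponents j ≡ k (mod m)
-- so large that L_{j-1} exceeds the sum of all previously chosen terms, the
-- terms x_N = L_j have all their finite sums in g|_k: adding a new largest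
-- term to a sum s ∈ g|_k lands at L_j + s, and g(L_j + s) = g(s) = k.
module Submission where

open import Defs
open import Data.Nat using (ℕ; _≤_; _<_)
open import Data.Nat using (zero; suc; _+_; _*_; pred; z≤n; s≤s; z<s; s≤s⁻¹; _≤′_; ≤′-refl; ≤′-step; _<ᵇ_; _≟_)
open import Data.Nat.Properties
open import Relation.Binary.PropositionalEquality
open import Data.Nat.ListAction using (sum)
open import Data.Nat.ListAction.Properties using (sum-↭)
open import Data.Nat.GeneralisedArithmetic using (iterate)
open import Data.Bool using (true; false)
open import Data.List using (List; []; _∷_; _++_; length; lookup; map; applyUpTo)
open import Data.List.Properties using (length-++; ++-identityʳ; concatMap-++; map-upTo)
open import Data.List.Relation.Unary.All using (All; []; _∷_)
import Data.List.Relation.Unary.All as All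
open import Data.List.Relation.Unary.All.Properties using (¬Any⇒All¬)
open import Data.List.Relation.Unary.Any using (any?)
open import Data.List.Relation.Unary.AllPairs using (_∷_)
open import Data.List.Relation.Unary.Unique.Propositional using (Unique)
open import Data.List.Membership.Propositional.Properties using (∈-∃++)
open import Data.List.Relation.Binary.Permutation.Propositional using (_↭_; ↭⇒↭ₛ)
open import Data.List.Relation.Binary.Permutation.Propositional.Properties using (shift; All-resp-↭; map⁺)
open import Data.List.Relation.Binary.Permutation.Setoid.Properties (setoid ℕ) using (Unique-resp-↭)
open import Data.Fin using (fromℕ<)
open import Data.Product using (∃; _,_; proj₂)
open import Data.Empty using (⊥-elim)
open import Relation.Nullary using (yes; no)
open ≡-Reasoning

-- Total indexing; the junk value 0 past the end of the word is never read.
_!_ : List ℕ → ℕ → ℕ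
[] ! _ = 0
(a ∷ w) ! zero = a
(a ∷ w) ! suc i = w ! i

lookup≡! : ∀ w i (i<∣w∣ : i < length w) → lookup w (fromℕ< i<∣w∣) ≡ w ! i
lookup≡! (a ∷ w) zero _ = refl
lookup≡! (a ∷ w) (suc i) i<∣w∣ = lookup≡! w i (s≤s⁻¹ i<∣w∣)

!-++ˡ : ∀ u v {i} → i < length u → (u ++ v) ! i ≡ u ! i
!-++ˡ (a ∷ u) v {zero} _ = refl
!-++ˡ (a ∷ u) v {suc i} i<∣u∣ = !-++ˡ u v (s≤s⁻¹ i<∣u∣)

!-++ʳ : ∀ u v i → (u ++ v) ! (length u + i) ≡ v ! i
!-++ʳ [] v i = refl
!-++ʳ (a ∷ u) v i = !-++ʳ u v i

lastLetter : List ℕ → ℕ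
lastLetter w = w ! pred (length w)

lastLetter-++ : ∀ u v → 0 < length v → lastLetter (u ++ v) ≡ lastLetter v
lastLetter-++ u (b ∷ v) _ = begin
  (u ++ b ∷ v) ! pred (length (u ++ b ∷ v))
    ≡⟨ cong (λ l → (u ++ b ∷ v) ! pred l) (trans (length-++ u) (+-suc (length u) (length v))) ⟩
  (u ++ b ∷ v) ! (length u + length v)
    ≡⟨ !-++ʳ u (b ∷ v) (length v) ⟩
  (b ∷ v) ! length v ∎

_≼_ : List ℕ → (ℕ → ℕ) → Set
w ≼ t = ∀ i → i < length w → w ! i ≡ t i

isPrefixOf⇒≼ : ∀ {w t} → IsPrefixOf w t → w ≼ t
isPrefixOf⇒≼ {w} w-prefix i i<∣w∣ = trans (sym (lookup≡! w i i<∣w∣)) (w-prefix i i<∣w∣)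

≼⇒≡applyUpTo : ∀ t w → w ≼ t → w ≡ applyUpTo t (length w)
≼⇒≡applyUpTo t [] _ = refl
≼⇒≡applyUpTo t (a ∷ w) a∷w≼t =
  cong₂ _∷_ (a∷w≼t 0 z<s) (≼⇒≡applyUpTo (λ i → t (suc i)) w (λ i i<∣w∣ → a∷w≼t (suc i) (s≤s i<∣w∣)))

≼⇒≡prefix : ∀ {t} w → w ≼ t → w ≡ prefix t (length w)
≼⇒≡prefix {t} w w≼t = trans (≼⇒≡applyUpTo t w w≼t) (sym (map-upTo t (length w)))

≼-repeat : ∀ {t} u v r → (u ++ v ++ r) ≼ t → v ≼ t → ∀ i → i < length v → t (length u + i) ≡ t i
≼-repeat {t} u v r uvr≼t v≼t i i<∣v∣ = begin
  t (length u + i)             ≡⟨ sym (uvr≼t (length u + i) within) ⟩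
  (u ++ v ++ r) ! (length u + i) ≡⟨ !-++ʳ u (v ++ r) i ⟩
  (v ++ r) ! i                 ≡⟨ !-++ˡ v r i<∣v∣ ⟩
  v ! i                        ≡⟨ v≼t i i<∣v∣ ⟩
  t i                          ∎
  where
  within : length u + i < length (u ++ v ++ r)
  within = subst (length u + i <_)
    (sym (trans (length-++ u) (cong (length u +_) (length-++ v))))
    (+-monoʳ-< (length u) (<-≤-trans i<∣v∣ (m≤m+n (length v) (length r))))

≼⇒cons0-length : ∀ {t} w → w ≼ t → 0 < length w → cons0 t (length w) ≡ lastLetter w
≼⇒cons0-length (a ∷ w) a∷w≼t _ = sym (a∷w≼t (length w) ≤-refl)

-- Finite sums of a greedily chosen sequence

data TopSplit (N : ℕ) (F : List ℕ) : Set where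
  below : All (_< N) F → TopSplit N F
  split : ∀ {F′} → F ↭ N ∷ F′ → Unique F′ → All (_< N) F′ → TopSplit N F

avoiding-<-suc : ∀ {N F} → All (_< suc N) F → All (λ i → N ≢ i) F → All (_< N) F
avoiding-<-suc F<1+N N∉F =
  All.zipWith (λ (i<1+N , N≢i) → ≤∧≢⇒< (s≤s⁻¹ i<1+N) (λ i≡N → N≢i (sym i≡N))) (F<1+N , N∉F)

topSplit : ∀ N F → Unique F → All (_< suc N) F → TopSplit N F
topSplit N F F! F<1+N with any? (N ≟_) F
... | no N∉F = below (avoiding-<-suc F<1+N (¬Any⇒All¬ F N∉F))
... | yes N∈F with us , vs , refl ← ∈-∃++ N∈F
  with N∉F′ ∷ F′! ← Unique-resp-↭ (↭⇒↭ₛ (shift N us vs)) F!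
     | _ ∷ F′<1+N ← All-resp-↭ (shift N us vs) F<1+N
  = split (shift N us vs) F′! (avoiding-<-suc F′<1+N N∉F′)

All-<-suc-sum : ∀ F → All (_< suc (sum F)) F
All-<-suc-sum [] = []
All-<-suc-sum (a ∷ F) =
  s≤s (m≤m+n a (sum F)) ∷ All.map (λ i<1+ΣF → <-≤-trans i<1+ΣF (s≤s (m≤n+m (sum F) a))) (All-<-suc-sum F)

module GreedySums (step : ℕ → ℕ) where

  partialSum : ℕ → ℕ
  partialSum zero = 0
  partialSum (suc N) = partialSum N + step (partialSum N)

  term : ℕ → ℕ
  term N = step (partialSum N)

  term-strictlyIncreasing : (∀ b → 0 < step b) → (∀ {a b} → a < b → step a < step b) →
    StrictlyIncreasing term
  term-strictlyIncreasing step-pos step-mono N = step-mono (m<m+n (partialSum N) (step-pos _))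

  sumOfTerms : List ℕ → ℕ
  sumOfTerms F = sum (map term F)

  sumOfTerms-↭ : ∀ {F G} → F ↭ G → sumOfTerms F ≡ sumOfTerms G
  sumOfTerms-↭ F↭G = sum-↭ (map⁺ term F↭G)

  sumOfTerms≤partialSum : ∀ N F → Unique F → All (_< N) F → sumOfTerms F ≤ partialSum N
  sumOfTerms≤partialSum zero [] _ _ = z≤n
  sumOfTerms≤partialSum zero (_ ∷ _) _ (() ∷ _)
  sumOfTerms≤partialSum (suc N) F F! F<1+N with topSplit N F F! F<1+N
  ... | below F<N = ≤-trans (sumOfTerms≤partialSum N F F! F<N) (m≤m+n (partialSum N) (term N))
  ... | split {F′} F↭N∷F′ F′! F′<N =
    subst₂ _≤_ (sym (sumOfTerms-↭ F↭N∷F′)) (+-comm (term N) (partialSum N))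
      (+-monoʳ-≤ (term N) (sumOfTerms≤partialSum N F′ F′! F′<N))

  module _ (A : ℕ → Set) (step∈A : ∀ b → A (step b))
           (step+∈A : ∀ b s → 0 < s → s ≤ b → A s → A (step b + s)) where

    sumOfTerms∈A : ∀ N F → Unique F → All (_< N) F → F ≢ [] → A (sumOfTerms F)
    sumOfTerms∈A zero [] _ _ F≢[] = ⊥-elim (F≢[] refl)
    sumOfTerms∈A zero (_ ∷ _) _ (() ∷ _) _
    sumOfTerms∈A (suc N) F F! F<1+N F≢[] with topSplit N F F! F<1+N
    ... | below F<N = sumOfTerms∈A N F F! F<N F≢[]
    ... | split {F′} F↭N∷F′ F′! F′<N =
      subst A (sym (sumOfTerms-↭ F↭N∷F′)) (term+∈A (sumOfTerms F′) refl)
      where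
      term+∈A : ∀ s → s ≡ sumOfTerms F′ → A (term N + s)
      term+∈A zero _ = subst A (sym (+-identityʳ (term N))) (step∈A (partialSum N))
      term+∈A (suc s) s≡ΣF′ = step+∈A (partialSum N) (suc s) z<s
        (subst (_≤ partialSum N) (sym s≡ΣF′) (sumOfTerms≤partialSum N F′ F′! F′<N))
        (subst A (sym s≡ΣF′) (sumOfTerms∈A N F′ F′! F′<N F′≢[]))
        where
        F′≢[] : F′ ≢ []
        F′≢[] refl = 0≢1+n (sym s≡ΣF′)

isIPSet-greedy : (A : ℕ → Set) (step : ℕ → ℕ) →
  (∀ b → 0 < step b) → (∀ {a b} → a < b → step a < step b) →
  (∀ b → A (step b)) → (∀ b s → 0 < s → s ≤ b → A s → A (step b + s)) →
  IsIPSet A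
isIPSet-greedy A step step-pos step-mono step∈A step+∈A =
  term , term-strictlyIncreasing step-pos step-mono ,
  λ F F≢[] F! → sumOfTerms∈A A step∈A step+∈A (suc (sum F)) F F! (All-<-suc-sum F) F≢[]
  where open GreedySums step

-- The m-bonacci substitution

module Bonacci (n : ℕ) where

  m : ℕ
  m = 2 + n

  σ^* : ℕ → List ℕ → List ℕ
  σ^* j w = iterate (σ* m) w j

  σ^ : ℕ → ℕ → List ℕ
  σ^ j i = σ^* j (i ∷ [])

  L : ℕ → ℕ
  L j = length (σ^ j 0)

  σ-startsWith0 : ∀ i → ∃ λ r → σ m i ≡ 0 ∷ r
  σ-startsWith0 i with suc i <ᵇ m
  ... | true = _ , refl
  ... | false = _ , refl

  σ-succ : ∀ {i} → suc i < m → σ m i ≡ 0 ∷ suc i ∷ []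
  σ-succ {i} 1+i<m with suc i <ᵇ m | <⇒<ᵇ 1+i<m
  ... | true | _ = refl

  σ-top : σ m (suc n) ≡ 0 ∷ []
  σ-top with m <ᵇ m | <ᵇ⇒< m m
  ... | false | _ = refl
  ... | true | m<m = ⊥-elim (<-irrefl refl (m<m _))

  σ^*-++ : ∀ j u v → σ^* j (u ++ v) ≡ σ^* j u ++ σ^* j v
  σ^*-++ zero u v = refl
  σ^*-++ (suc j) u v = trans (cong (σ^* j) (concatMap-++ (σ m) u v)) (σ^*-++ j (σ* m u) (σ* m v))

  σ^*-suc : ∀ j w → σ^* (suc j) w ≡ σ* m (σ^* j w)
  σ^*-suc zero w = refl
  σ^*-suc (suc j) w = σ^*-suc j (σ* m w)

  σ^-suc : ∀ j i → σ^ (suc j) i ≡ σ^* j (σ m i)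
  σ^-suc j i = cong (σ^* j) (++-identityʳ (σ m i))

  σ^-suc-startsWith : ∀ j i → ∃ λ r → σ^ (suc j) i ≡ σ^ j 0 ++ σ^* j r
  σ^-suc-startsWith j i with r , σi≡0r ← σ-startsWith0 i =
    r , trans (σ^-suc j i) (trans (cong (σ^* j) σi≡0r) (σ^*-++ j (0 ∷ []) r))

  σ^-suc-succ : ∀ j {i} → suc i < m → σ^ (suc j) i ≡ σ^ j 0 ++ σ^ j (suc i)
  σ^-suc-succ j {i} 1+i<m =
    trans (σ^-suc j i) (trans (cong (σ^* j) (σ-succ 1+i<m)) (σ^*-++ j (0 ∷ []) (suc i ∷ [])))

  σ^-nonempty : ∀ j i → 0 < length (σ^ j i)
  σ^-nonempty zero i = z<s
  σ^-nonempty (suc j) i with r , eq ← σ^-suc-startsWith j i =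
    subst (λ w → 0 < length w) (sym eq)
      (subst (0 <_) (sym (length-++ (σ^ j 0))) (<-≤-trans (σ^-nonempty j 0) (m≤m+n (L j) _)))

  L-<-suc : ∀ j → L j < L (suc j)
  L-<-suc j = subst (λ w → L j < length w) (sym (σ^-suc-succ j (s≤s (s≤s z≤n))))
    (subst (L j <_) (sym (length-++ (σ^ j 0))) (m<m+n (L j) (σ^-nonempty j 1)))

  L-strictMono : ∀ {a b} → a < b → L a < L b
  L-strictMono {a} a<b = go (≤⇒≤′ a<b)
    where
    go : ∀ {b} → suc a ≤′ b → L a < L b
    go ≤′-refl = L-<-suc a
    go {suc b} (≤′-step a<b) = <-trans (go a<b) (L-<-suc b)

  j<L : ∀ j → j < L j
  j<L zero = z<s
  j<L (suc j) = <-≤-trans (s≤s (j<L j)) (L-<-suc j)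

  lastLetter-σ^-shift : ∀ r j i → r + i < m → lastLetter (σ^ (r + j) i) ≡ lastLetter (σ^ j (r + i))
  lastLetter-σ^-shift zero j i _ = refl
  lastLetter-σ^-shift (suc r) j i 1+r+i<m = begin
    lastLetter (σ^ (suc (r + j)) i)         ≡⟨ cong lastLetter (σ^-suc-succ (r + j) 1+i<m) ⟩
    lastLetter (σ^ (r + j) 0 ++ σ^ (r + j) (suc i))
      ≡⟨ lastLetter-++ (σ^ (r + j) 0) _ (σ^-nonempty (r + j) (suc i)) ⟩
    lastLetter (σ^ (r + j) (suc i))         ≡⟨ lastLetter-σ^-shift r j (suc i) r+1+i<m ⟩
    lastLetter (σ^ j (r + suc i))           ≡⟨ cong (λ l → lastLetter (σ^ j l)) (+-suc r i) ⟩
    lastLetter (σ^ j (suc r + i))           ∎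
    where
    1+i<m : suc i < m
    1+i<m = ≤-<-trans (s≤s (m≤n+m i r)) 1+r+i<m
    r+1+i<m : r + suc i < m
    r+1+i<m = subst (_< m) (sym (+-suc r i)) 1+r+i<m

  lastLetter-σ^-period : ∀ j → lastLetter (σ^ (m + j) 0) ≡ lastLetter (σ^ j 0)
  lastLetter-σ^-period j = begin
    lastLetter (σ^ (suc (suc n + j)) 0)
      ≡⟨ cong (λ e → lastLetter (σ^ e 0)) (sym (+-suc (suc n) j)) ⟩
    lastLetter (σ^ (suc n + suc j) 0)
      ≡⟨ lastLetter-σ^-shift (suc n) (suc j) 0 (subst (_< m) (sym (+-identityʳ (suc n))) ≤-refl) ⟩
    lastLetter (σ^ (suc j) (suc n + 0))
      ≡⟨ cong (λ i → lastLetter (σ^ (suc j) i)) (+-identityʳ (suc n)) ⟩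
    lastLetter (σ^ (suc j) (suc n))
      ≡⟨ cong lastLetter (trans (σ^-suc j (suc n)) (cong (σ^* j) σ-top)) ⟩
    lastLetter (σ^ j 0) ∎

  lastLetter-σ^0 : ∀ {k} → k < m → ∀ c → lastLetter (σ^ (m * c + k) 0) ≡ k
  lastLetter-σ^0 {k} k<m zero = begin
    lastLetter (σ^ (m * 0 + k) 0)
      ≡⟨ cong (λ e → lastLetter (σ^ e 0)) (trans (cong (_+ k) (*-zeroʳ m)) (sym (+-identityʳ k))) ⟩
    lastLetter (σ^ (k + 0) 0)
      ≡⟨ lastLetter-σ^-shift k 0 0 (subst (_< m) (sym (+-identityʳ k)) k<m) ⟩
    k + 0
      ≡⟨ +-identityʳ k ⟩
    k ∎
  lastLetter-σ^0 {k} k<m (suc c) = begin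
    lastLetter (σ^ (m * suc c + k) 0)
      ≡⟨ cong (λ e → lastLetter (σ^ e 0)) (trans (cong (_+ k) (*-suc m c)) (+-assoc m (m * c) k)) ⟩
    lastLetter (σ^ (m + (m * c + k)) 0)
      ≡⟨ lastLetter-σ^-period (m * c + k) ⟩
    lastLetter (σ^ (m * c + k) 0)
      ≡⟨ lastLetter-σ^0 k<m c ⟩
    k ∎

  module FixedPoint (t : ℕ → ℕ) (t-fixed : IsFixedPoint m t) where

    g : ℕ → ℕ
    g = cons0 t

    σ*prefix≼t : ∀ l → σ* m (prefix t l) ≼ t
    σ*prefix≼t l = isPrefixOf⇒≼ {σ* m (prefix t l)} (proj₂ t-fixed l)

    t0≡0 : t 0 ≡ 0
    t0≡0 with r , σt0≡0r ← σ-startsWith0 (t 0) = begin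
      t 0
        ≡⟨ sym (σ*prefix≼t 1 0 (subst (λ w → 0 < length w) (cong (_++ []) (sym σt0≡0r)) z<s)) ⟩
      (σ m (t 0) ++ []) ! 0
        ≡⟨ cong (λ w → (w ++ []) ! 0) σt0≡0r ⟩
      0 ∎

    σ^0≼t : ∀ j → σ^ j 0 ≼ t
    σ^0≼t zero zero _ = sym t0≡0
    σ^0≼t zero (suc i) (s≤s ())
    σ^0≼t (suc j) i i<L = begin
      σ^ (suc j) 0 ! i          ≡⟨ cong (_! i) σ^0≡σ*prefix ⟩
      σ* m (prefix t (L j)) ! i ≡⟨ σ*prefix≼t (L j) i (subst (λ w → i < length w) σ^0≡σ*prefix i<L) ⟩
      t i                       ∎
      where
      σ^0≡σ*prefix : σ^ (suc j) 0 ≡ σ* m (prefix t (L j))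
      σ^0≡σ*prefix = trans (σ^*-suc j (0 ∷ [])) (cong (σ* m) (≼⇒≡prefix (σ^ j 0) (σ^0≼t j)))

    t-period : ∀ j i → i < L j → t (L (suc j) + i) ≡ t i
    t-period j with r , σ^1≡ ← σ^-suc-startsWith j 1 =
      ≼-repeat (σ^ (suc j) 0) (σ^ j 0) (σ^* j r) (subst (_≼ t) σ^0≡ (σ^0≼t (2 + j))) (σ^0≼t j)
      where
      σ^0≡ : σ^ (2 + j) 0 ≡ σ^ (suc j) 0 ++ σ^ j 0 ++ σ^* j r
      σ^0≡ = trans (σ^-suc-succ (suc j) (s≤s (s≤s z≤n))) (cong (σ^ (suc j) 0 ++_) σ^1≡)

    g-period : ∀ j s → 0 < s → s ≤ L j → g (L (suc j) + s) ≡ g s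
    g-period j (suc s) _ 1+s≤L = trans (cong g (+-suc (L (suc j)) s)) (t-period j s 1+s≤L)

    g-L : ∀ j → g (L j) ≡ lastLetter (σ^ j 0)
    g-L j = ≼⇒cons0-length (σ^ j 0) (σ^0≼t j) (σ^-nonempty j 0)

    -- m * suc b + k reduces to suc (b + suc n * suc b + k).
    level-isIPSet : ∀ k → k < m → IsIPSet (level g k)
    level-isIPSet k k<m = isIPSet-greedy (level g k) (λ b → L (m * suc b + k))
      (λ b → σ^-nonempty (m * suc b + k) 0)
      (λ a<b → L-strictMono (+-monoˡ-< k (*-monoʳ-< m (s≤s a<b))))
      (λ b → trans (g-L (m * suc b + k)) (lastLetter-σ^0 k<m (suc b)))
      (λ b s 0<s s≤b gs≡k → trans (g-period (b + suc n * suc b + k) s 0<s (s≤L b s≤b)) gs≡k)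
      where
      s≤L : ∀ b {s} → s ≤ b → s ≤ L (b + suc n * suc b + k)
      s≤L b s≤b = ≤-trans s≤b (<⇒≤ (≤-<-trans (≤-trans (m≤m+n b _) (m≤m+n _ k)) (j<L _)))

proposition4p2 : (m : ℕ) → 2 ≤ m → (t : ℕ → ℕ) → IsFixedPoint m t →
    (k : ℕ) → k < m → IsIPSet (level (cons0 t) k)
proposition4p2 (suc (suc n)) _ t t-fixed = Bonacci.FixedPoint.level-isIPSet n t t-fixed
proposition4p2 (suc zero) (s≤s ())
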